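{- For every $D\ge 3$, the set of $D$-edge-colorable graphs is neither meager nor comeager in $\mathfrak{G}^{\infty}_{\le D}$.
   Context: Graphs are simple. A graph is $D$-edge-colorable if its edges can be colored with $D$ colors so that edges sharing an endpoint get distinct colors. $\mathfrak{G}^{\infty}_{\le D}$ is the set of connected infinite graphs of maximum degree at most $D$, up to isomorphism. For a graph $G$ and $r\ge 0$, $B_r(G,v)$ is the subgraph induced by the vertices at distance at most $r$ from $v$, rooted at $v$, and $\mathfrak{B}_r(G)=\{B_r(G,v): v\in V(G)\}$, a set of rooted graphs up to root-preserving isomorphism (multiplicities ignored). $\mathfrak{G}^{\infty}_{\le D}$ carries the topology of the pseudometric $d(G_1,G_2)=\inf\{2^{ -r}: \mathfrak{B}_r(G_1)=\mathfrak{B}_r(G_2)\}$. A subset $S$ of a space $X$ is nowhere dense in $X$ if every non-empty open $U\subseteq X$ contains a non-empty open $U'\subseteq U$ with $U'\cap S=\emptyset$; meager if it is a countable union of nowhere dense sets; comeager if its complement is meager. -}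

module Defs where

open import Level using (Level; 0ℓ; _⊔_) renaming (suc to lsuc)
open import Data.Fin.Base using (Fin)
open import Data.Integer.Base using (+_)
open import Data.List.Base using (List; length)
import Data.List.Membership.Setoid as Membership
open import Data.Nat.Base as ℕ using (ℕ; zero; suc; _^_)
open import Data.Nat.Properties using (m^n≢0)
open import Data.Product.Base using (Σ; Σ-syntax; ∃; ∃-syntax; _×_; _,_; proj₁; proj₂)
open import Data.Rational.Unnormalised.Base using (ℚᵘ; 0ℚᵘ; _/_; _<_)
open import Function.Base using (_∘_; _on_)
open import Function.Bundles using (Inverse; Surjection; _⇔_; Equivalence; mk⇔)
import Function.Construct.Composition as Composition
import Function.Construct.Identity as Identity
import Function.Construct.Symmetry as Symmetry
open import Relation.Binary.Bundles using (Setoid)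
open import Relation.Binary.Core using (Rel)
open import Relation.Binary.Definitions
  using (Irreflexive; Symmetric; _Respects_; _Respects₂_)
import Relation.Binary.Construct.On as On
open import Relation.Binary.PropositionalEquality
  using (_≡_; _≢_; setoid)
open import Relation.Nullary using (¬_)
open import Relation.Unary using (Pred; _∈_; _⊆_; _≐_; _⊥_; ⋃; ∁; Satisfiable)

-- The points of the space are the classes of X, so a set of points is a
-- predicate invariant under the equivalence.
record Subset {a e} (X : Setoid a e) (ℓ : Level) : Set (a ⊔ e ⊔ lsuc ℓ) where
  field
    member : Pred (Setoid.Carrier X) ℓ
    resp   : member Respects (Setoid._≈_ X)

open Subset public

complement : ∀ {a e ℓ} {X : Setoid a e} → Subset X ℓ → Subset X ℓ
complement {X = X} S = record
  { member = ∁ (member S)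
  ; resp   = λ x≈y x∉S y∈S → x∉S (resp S (Setoid.sym X x≈y) y∈S)
  }

module Category {a e ℓ o : Level} (X : Setoid a e) (Open : Subset X ℓ → Set o) where

  NowhereDense : ∀ {s} → Subset X s → Set (a ⊔ e ⊔ lsuc ℓ ⊔ o ⊔ s)
  NowhereDense S =
    ∀ (U : Subset X ℓ) → Open U → Satisfiable (member U) →
    Σ[ U′ ∈ Subset X ℓ ]
      Open U′ × Satisfiable (member U′) ×
      member U′ ⊆ member U × member U′ ⊥ member S

  Meager : ∀ {s} → Subset X s → Set (a ⊔ e ⊔ lsuc ℓ ⊔ o ⊔ s)
  Meager S =
    Σ[ T ∈ (ℕ → Subset X ℓ) ]
      (∀ n → NowhereDense (T n)) × member S ≐ ⋃ ℕ (λ n → member (T n))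

  Comeager : ∀ {s} → Subset X s → Set (a ⊔ e ⊔ lsuc ℓ ⊔ o ⊔ s)
  Comeager S = Meager (complement S)

-- The vertices form a setoid so that an induced subgraph can be carried by
-- pairs (vertex , membership proof) compared by their first components.
record Graph : Set₁ where
  field
    vertices : Setoid 0ℓ 0ℓ

  open Setoid vertices public using (_≈_) renaming (Carrier to V)

  field
    Adj      : Rel V 0ℓ
    Adj-resp : Adj Respects₂ _≈_
    Adj-sym  : Symmetric Adj
    Adj-irr  : Irreflexive _≈_ Adj

  data Walk : ℕ → V → V → Set where
    stop : ∀ {u v} → u ≈ v → Walk zero u v
    step : ∀ {n u v w} → Adj u v → Walk n v w → Walk (suc n) u w

  Distance≤ : ℕ → V → V → Set
  Distance≤ r u v = ∃[ n ] (n ℕ.≤ r × Walk n u v)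

  Connected : Set
  Connected = ∀ u v → ∃[ n ] Walk n u v

  Finite : Set
  Finite = ∃[ n ] Surjection (setoid (Fin n)) vertices

  Infinite : Set
  Infinite = ¬ Finite

  open Membership vertices using () renaming (_∈_ to _∈ᴸ_)

  -- The list may contain repetitions; its length bounds the degree from above.
  MaxDegree≤ : ℕ → Set
  MaxDegree≤ D =
    ∀ v → Σ[ ns ∈ List V ] (length ns ℕ.≤ D × (∀ {w} → Adj v w → w ∈ᴸ ns))

open Graph public using (V; Adj; vertices; Distance≤)

-- An edge uv is presented by the two orientations Adj u v and Adj v u;
-- `well-defined` and `unoriented` make the colour depend on the edge alone.
record EdgeColouring (D : ℕ) (G : Graph) : Set where
  open Graph G using (_≈_)
  field
    colour       : ∀ {u v} → Adj G u v → Fin D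
    well-defined : ∀ {u v u′ v′} (e : Adj G u v) (e′ : Adj G u′ v′) →
                   u ≈ u′ → v ≈ v′ → colour e ≡ colour e′
    unoriented   : ∀ {u v} (e : Adj G u v) (e′ : Adj G v u) → colour e ≡ colour e′
    proper       : ∀ {u v w} (e : Adj G u v) (f : Adj G u w) →
                   ¬ (v ≈ w) → colour e ≢ colour f

EdgeColourable : ℕ → Graph → Set
EdgeColourable D G = EdgeColouring D G

record _≅_ (G H : Graph) : Set where
  field
    bijection : Inverse (vertices G) (vertices H)
  open Inverse bijection public using (to; from)
  field
    adjacency : ∀ u v → Adj G u v ⇔ Adj H (to u) (to v)

infix 4 _≅_

≅-refl : ∀ {G} → G ≅ G
≅-refl {G} = record
  { bijection = Identity.inverse (vertices G)
  ; adjacency = λ u v → mk⇔ (λ e → e) (λ e → e)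
  }

≅-sym : ∀ {G H} → G ≅ H → H ≅ G
≅-sym {G} {H} i = record
  { bijection = Symmetry.inverse bijection
  ; adjacency = λ u v → mk⇔
      (λ e → Equivalence.from (adjacency (from u) (from v))
               (respʳ (H.sym (strictlyInverseˡ v)) (respˡ (H.sym (strictlyInverseˡ u)) e)))
      (λ e → respʳ (strictlyInverseˡ v) (respˡ (strictlyInverseˡ u)
               (Equivalence.to (adjacency (from u) (from v)) e)))
  }
  where
  open _≅_ i
  open Inverse bijection using (strictlyInverseˡ)
  module H = Setoid (vertices H)
  respʳ : ∀ {x y z} → H._≈_ y z → Adj H x y → Adj H x z
  respʳ = proj₁ (Graph.Adj-resp H)
  respˡ : ∀ {x y z} → H._≈_ y z → Adj H y x → Adj H z x
  respˡ = proj₂ (Graph.Adj-resp H)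

≅-trans : ∀ {G H K} → G ≅ H → H ≅ K → G ≅ K
≅-trans i j = record
  { bijection = Composition.inverse i.bijection j.bijection
  ; adjacency = λ u v → mk⇔
      (Equivalence.to (j.adjacency _ _) ∘ Equivalence.to (i.adjacency u v))
      (Equivalence.from (i.adjacency u v) ∘ Equivalence.from (j.adjacency _ _))
  }
  where
  module i = _≅_ i
  module j = _≅_ j

record RootedGraph : Set₁ where
  field
    graph : Graph
    root  : V graph

open RootedGraph public

record _≅•_ (G H : RootedGraph) : Set where
  field
    iso       : graph G ≅ graph H
    preserves : Graph._≈_ (graph H) (_≅_.to iso (root G)) (root H)

infix 4 _≅•_

induced : (G : Graph) → Pred (V G) 0ℓ → Graph
induced G P = record
  { vertices = On.setoid {B = Σ (V G) P} (vertices G) proj₁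
  ; Adj      = Adj G on proj₁
  ; Adj-resp = proj₁ (Graph.Adj-resp G) , proj₂ (Graph.Adj-resp G)
  ; Adj-sym  = Graph.Adj-sym G
  ; Adj-irr  = Graph.Adj-irr G
  }

ball : ℕ → (G : Graph) → V G → RootedGraph
ball r G v = record
  { graph = induced G (Distance≤ G r v)
  ; root  = v , 0 , ℕ.z≤n , Graph.stop (Setoid.refl (vertices G))
  }

-- The set of balls up to root-preserving isomorphism, as the
-- isomorphism-closed predicate it generates.
𝔅 : ℕ → Graph → Pred RootedGraph 0ℓ
𝔅 r G H = ∃[ v ] H ≅• ball r G v

record InfiniteGraph (D : ℕ) : Set₁ where
  field
    underlying : Graph
    connected  : Graph.Connected underlying
    infinite   : Graph.Infinite underlying
    maxDegree  : Graph.MaxDegree≤ underlying D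

open InfiniteGraph public

𝔊∞≤ : ℕ → Setoid (lsuc 0ℓ) 0ℓ
𝔊∞≤ D = record
  { Carrier       = InfiniteGraph D
  ; _≈_           = _≅_ on underlying
  ; isEquivalence = record { refl = ≅-refl ; sym = ≅-sym ; trans = ≅-trans }
  }

2^-_ : ℕ → ℚᵘ
2^- r = _/_ (+ 1) (2 ^ r) {{m^n≢0 2 r}}

-- The infimum of { 2^- r : 𝔅 r G ≐ 𝔅 r H } lies strictly below ε exactly when
-- some element of that set does.
d[_,_]<_ : Graph → Graph → ℚᵘ → Set₁
d[ G , H ]< ε = ∃[ r ] (2^- r < ε × 𝔅 r G ≐ 𝔅 r H)

-- The balls of a pseudometric are a base of its topology.
Open : ∀ {D} → Subset (𝔊∞≤ D) (lsuc 0ℓ) → Set₁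
Open U = ∀ {G} → G ∈ member U →
  ∃[ ε ] (0ℚᵘ < ε × (∀ {H} → d[ underlying G , underlying H ]< ε → H ∈ member U))

EdgeColourable-resp : ∀ {D G H} → G ≅ H → EdgeColourable D G → EdgeColourable D H
EdgeColourable-resp {D} {G} {H} G≅H c = record
  { colour       = λ e → c.colour (pull e)
  ; well-defined = λ e e′ u≈u′ v≈v′ →
      c.well-defined (pull e) (pull e′) (from-cong u≈u′) (from-cong v≈v′)
  ; unoriented   = λ e e′ → c.unoriented (pull e) (pull e′)
  ; proper       = λ e f v≉w → c.proper (pull e) (pull f)
      (λ fv≈fw → v≉w (H.trans (H.sym (strictlyInverseˡ _))
                        (H.trans (to-cong fv≈fw) (strictlyInverseˡ _))))
  }
  where
  module c = EdgeColouring c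
  module H = Setoid (vertices H)
  open _≅_ G≅H
  open Inverse bijection using (to-cong; from-cong; strictlyInverseˡ)
  pull : ∀ {u v} → Adj H u v → Adj G (from u) (from v)
  pull = Equivalence.to (_≅_.adjacency (≅-sym G≅H) _ _)

edgeColourables : (D : ℕ) → Subset (𝔊∞≤ D) 0ℓ
edgeColourables D = record
  { member = λ G → EdgeColourable D (underlying G)
  ; resp   = EdgeColourable-resp
  }

{-# OPTIONS --safe #-}

-- Both halves exhibit an isolated point of the space: its singleton class is
-- open, so no nowhere dense set contains it, and hence neither does a meager
-- set. The isolated points are a ray, which is 2-edge-colourable, and a ray
-- attached to K_{D+1} with one edge subdivided, which has no D-edge-colouring
-- by parity. In both, the degree-two vertices are exactly the vertices of the
-- ray other than its start. If H has the same 3-balls, then it contains a copy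
-- of the core, and the ray can be followed in H from there; a second vertex of
-- degree other than two on the way would close H up to a finite graph.
module Submission where

open import Defs
import Algebra.Properties.CommutativeMonoid.Sum as CommutativeMonoidSum
open import Data.Bool.Base using (if_then_else_)
open import Data.Empty using (⊥; ⊥-elim)
open import Data.Fin.Base using (Fin; zero; suc; toℕ; punchIn; punchOut)
open import Data.Fin.Permutation using (permutation)
import Data.Fin.Properties as Fin
open import Data.Integer.Base as ℤ using ()
import Data.Integer.Properties as ℤ
open import Data.List.Base
  using (List; []; _∷_; _++_; length; lookup; map; tabulate; allFin; upTo)
open import Data.List.Membership.Propositional.Properties using (∈-allFin; ∈-upTo⁺)
import Data.List.Membership.Setoid as Membership
open import Data.List.Properties using (length-tabulate)
open import Data.List.Relation.Unary.Any as Any using (here; there)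
import Data.List.Relation.Unary.Any.Properties as Any
open import Data.Nat.Base as ℕ using (ℕ; zero; suc; _+_; _*_; _^_; _≤_; _<_; z≤n; s≤s)
open import Data.Nat.Properties
open import Data.Product.Base using (Σ-syntax; ∃; ∃-syntax; _×_; _,_; proj₁; proj₂)
import Data.Rational.Unnormalised.Base as ℚᵘ
import Data.Rational.Unnormalised.Properties as ℚᵘ
open import Data.Sum.Base using (_⊎_; inj₁; inj₂; [_,_]′; swap)
open import Data.Sum.Properties using (inj₁-injective; inj₂-injective; ≡-dec)
open import Function.Base using (_∘_)
open import Function.Bundles using (Equivalence; Inverse; Surjection; mk⇔)
open import Function.Definitions using (Injective)
open import Level using (0ℓ; Lift; lift; lower) renaming (suc to lsuc)
open import Relation.Binary.Bundles using (Setoid)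
open import Relation.Binary.Core using (Rel)
open import Relation.Binary.Definitions using (Symmetric; tri<; tri≈; tri>)
open import Relation.Binary.PropositionalEquality
  using (_≡_; _≢_; refl; sym; trans; cong; subst; setoid; module ≡-Reasoning)
open import Relation.Nullary using (¬_; Dec; yes; no; contradiction; does)
open import Relation.Nullary.Decidable using (decidable-stable; dec-true; dec-false)
open import Relation.Unary using (Pred; _≐_)

open Equivalence using () renaming (to to ⇒; from to ⇐)
module Sum = CommutativeMonoidSum +-0-commutativeMonoid

-- Walks

Adj-respʳ : ∀ G {u v w} → Graph._≈_ G v w → Adj G u v → Adj G u w
Adj-respʳ G = proj₁ (Graph.Adj-resp G)

Adj-respˡ : ∀ G {u v w} → Graph._≈_ G v w → Adj G v u → Adj G w u
Adj-respˡ G = proj₂ (Graph.Adj-resp G)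

module _ {G H : Graph} where
  private
    module G = Graph G
    module H = Graph H

  mapWalk : (f : V G → V H) → (∀ {u v} → u G.≈ v → f u H.≈ f v) →
            (∀ {u v} → Adj G u v → Adj H (f u) (f v)) →
            ∀ {n u v} → G.Walk n u v → H.Walk n (f u) (f v)
  mapWalk f f-cong f-adj (G.stop u≈v)   = H.stop (f-cong u≈v)
  mapWalk f f-cong f-adj (G.step uv vw) = H.step (f-adj uv) (mapWalk f f-cong f-adj vw)

module _ {G : Graph} where
  open Graph G using (_≈_; Walk; stop; step)
  open Membership (vertices G) using (_∈_)
  private module S = Setoid (vertices G)

  Walk-respʳ : ∀ {n u v w} → v ≈ w → Walk n u v → Walk n u w
  Walk-respʳ v≈w (stop u≈v) = stop (S.trans u≈v v≈w)
  Walk-respʳ v≈w (step e p) = step e (Walk-respʳ v≈w p)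

  snoc : ∀ {n u v w} → Walk n u v → Adj G v w → Walk (suc n) u w
  snoc (stop u≈v) vw = step (Adj-respˡ G (S.sym u≈v) vw) (stop S.refl)
  snoc (step e p) vw = step e (snoc p vw)

  _++ʷ_ : ∀ {m n u v w} → Walk m u v → Walk n v w → ∃[ l ] Walk l u w
  stop u≈v ++ʷ stop v≈w = _ , stop (S.trans u≈v v≈w)
  stop u≈v ++ʷ step e q = _ , step (Adj-respˡ G (S.sym u≈v) e) q
  step e p ++ʷ q        = _ , step e (proj₂ (p ++ʷ q))

  reverseWalk : ∀ {n u v} → Walk n u v → Walk n v u
  reverseWalk (stop u≈v) = stop (S.sym u≈v)
  reverseWalk (step e p) = snoc (reverseWalk p) (Graph.Adj-sym G e)

  module _ (P : V G → Set) (P-resp : ∀ {u v} → u ≈ v → P u → P v)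
           (P-closed : ∀ {u v} → Adj G u v → P u → P v) where

    walk-closed : ∀ {n u v} → Walk n u v → P u → P v
    walk-closed (stop u≈v) Pu = P-resp u≈v Pu
    walk-closed (step e p) Pu = walk-closed p (P-closed e Pu)

  list⇒finite : (xs : List (V G)) → (∀ v → v ∈ xs) → Graph.Finite G
  list⇒finite xs all = length xs , record
    { to         = lookup xs
    ; cong       = λ { refl → S.refl }
    ; surjective = λ v → Any.index (all v) , λ { refl → S.sym (Any.lookup-index (all v)) }
    }

  -- The prefix `p`, of length `a`, certifies that each vertex passed lies in the ball; generalising
  -- over it makes the induction go through.
  induced-walk : ∀ {r a n g u v} → Walk a g u → a + n ≤ r → Walk n u v →
                 (du : Distance≤ G r g u) (dv : Distance≤ G r g v) →
                 Graph.Walk (induced G (Distance≤ G r g)) n (u , du) (v , dv)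
  induced-walk p a+n≤r (stop u≈v) du dv = Graph.stop u≈v
  induced-walk {r} {a} {suc n} p a+n≤r (step e q) du dv =
    Graph.step e (induced-walk (snoc p e) 1+a+n≤r q
      (suc a , ≤-trans (m≤m+n (suc a) n) 1+a+n≤r , snoc p e) dv)
    where 1+a+n≤r = subst (_≤ r) (+-suc a n) a+n≤r

-- Rooted isomorphisms and balls

≅•-refl : ∀ {G} → G ≅• G
≅•-refl {G} = record { iso = ≅-refl ; preserves = Setoid.refl (vertices (graph G)) }

≅•-sym : ∀ {G H} → G ≅• H → H ≅• G
≅•-sym {G} {H} ψ = record
  { iso       = ≅-sym (_≅•_.iso ψ)
  ; preserves = G.trans (from-cong (H.sym (_≅•_.preserves ψ))) (strictlyInverseʳ _)
  }
  where
  open Inverse (_≅_.bijection (_≅•_.iso ψ))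
  module G = Setoid (vertices (graph G))
  module H = Setoid (vertices (graph H))

≅•-trans : ∀ {G H K} → G ≅• H → H ≅• K → G ≅• K
≅•-trans {K = K} φ ψ = record
  { iso       = ≅-trans (_≅•_.iso φ) (_≅•_.iso ψ)
  ; preserves = Setoid.trans (vertices (graph K))
      (Inverse.to-cong (_≅_.bijection (_≅•_.iso ψ)) (_≅•_.preserves φ)) (_≅•_.preserves ψ)
  }

ball-≅ : ∀ {G H} (i : G ≅ H) r v → ball r G v ≅• ball r H (_≅_.to i v)
ball-≅ {G} {H} i r v = record
  { iso = record
    { bijection = record
      { to        = λ (u , n , n≤r , p) → to u , n , n≤r , mapWalk to to-cong to-adj p
      ; from      = λ (u , n , n≤r , p) →
          from u , n , n≤r , Walk-respˡ (strictlyInverseʳ v) (mapWalk from from-cong from-adj p)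
      ; to-cong   = to-cong
      ; from-cong = from-cong
      ; inverse   = inverseˡ , inverseʳ
      }
    ; adjacency = λ (u , _) (w , _) → adjacency u w
    }
  ; preserves = Setoid.refl (vertices H)
  }
  where
  open _≅_ i using (bijection; adjacency)
  open Inverse bijection
  to-adj : ∀ {u w} → Adj G u w → Adj H (to u) (to w)
  to-adj = ⇒ (adjacency _ _)
  from-adj : ∀ {u w} → Adj H u w → Adj G (from u) (from w)
  from-adj = ⇒ (_≅_.adjacency (≅-sym i) _ _)
  Walk-respˡ : ∀ {n u w x} → Graph._≈_ G u w → Graph.Walk G n u x → Graph.Walk G n w x
  Walk-respˡ u≈w p = reverseWalk (Walk-respʳ u≈w (reverseWalk p))

𝔅-≅ : ∀ {G H} → G ≅ H → ∀ r → 𝔅 r G ≐ 𝔅 r H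
𝔅-≅ i r =
  (λ (v , φ) → _≅_.to i v , ≅•-trans φ (ball-≅ i r v)) ,
  (λ (v , φ) → _≅_.to (≅-sym i) v , ≅•-trans φ (ball-≅ (≅-sym i) r v))

-- The radii `2^- r`

unitFraction-positive : ∀ d .{{_ : ℕ.NonZero d}} → ℚᵘ.0ℚᵘ ℚᵘ.< ℤ.+ 1 ℚᵘ./ d
unitFraction-positive (suc d) = ℚᵘ.positive⁻¹ _

-- With a variable denominator, matching on `suc` lets the fraction compute; `2 ^ n` would block it.
unitFraction-cancel-< : ∀ d e .{{_ : ℕ.NonZero d}} .{{_ : ℕ.NonZero e}} →
                        ℤ.+ 1 ℚᵘ./ d ℚᵘ.< ℤ.+ 1 ℚᵘ./ e → e < d
unitFraction-cancel-< (suc d) (suc e) (ℚᵘ.*<* 1*e<1*d)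
  rewrite ℤ.*-identityˡ (ℤ.+ suc e) | ℤ.*-identityˡ (ℤ.+ suc d) = ℤ.drop‿+<+ 1*e<1*d

2^-positive : ∀ n → ℚᵘ.0ℚᵘ ℚᵘ.< 2^- n
2^-positive n = unitFraction-positive (2 ^ n) {{m^n≢0 2 n}}

2^-cancel-< : ∀ m n → 2^- m ℚᵘ.< 2^- n → n < m
2^-cancel-< m n p = ≰⇒> λ m≤n →
  <⇒≱ (unitFraction-cancel-< (2 ^ m) (2 ^ n) {{m^n≢0 2 m}} {{m^n≢0 2 n}} p) (^-monoʳ-≤ 2 m≤n)

-- Isolated points

-- All scales `s` from `r` on are quantified, because a distance below `2^- r` supplies equality of
-- balls at some such `s`.
Isolated : ∀ {D} → InfiniteGraph D → Set₁
Isolated {D} G = Σ[ r ∈ ℕ ] ∀ (H : InfiniteGraph D) {s} → r ≤ s →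
  𝔅 s (underlying G) ≐ 𝔅 s (underlying H) → underlying G ≅ underlying H

module _ {D : ℕ} where
  open Category (𝔊∞≤ D) Open

  class : (G : InfiniteGraph D) → Subset (𝔊∞≤ D) (lsuc 0ℓ)
  class G = record
    { member = λ H → Lift _ (underlying G ≅ underlying H)
    ; resp   = λ H≅K (lift G≅H) → lift (≅-trans G≅H H≅K)
    }

  class-open : (G : InfiniteGraph D) → Isolated G → Open (class G)
  -- The radius `2^- r` serves at every `H` in the class, since `G` and `H` have the same balls.
  class-open G (r , rigid) {H} (lift G≅H) = 2^- r , 2^-positive r , λ {K} (s , 2^-s<2^-r , H≐K) →
    let G≐H = 𝔅-≅ G≅H s in
    lift (rigid K (<⇒≤ (2^-cancel-< s r 2^-s<2^-r))
      ((λ x → proj₁ H≐K (proj₁ G≐H x)) , (λ x → proj₂ G≐H (proj₂ H≐K x))))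

  isolated⇒nonmeager : ∀ {ℓ} (S : Subset (𝔊∞≤ D) ℓ) (G : InfiniteGraph D) →
                       Isolated G → member S G → ¬ Meager S
  isolated⇒nonmeager S G iso G∈S (T , nowhere , S⊆⋃ , _)
    with n , G∈Tn ← S⊆⋃ G∈S
    with U′ , _ , (H , H∈U′) , U′⊆U , U′⊥Tn ←
      nowhere n (class G) (λ {H} → class-open G iso {H}) (G , lift ≅-refl)
    -- `H` is isomorphic to `G`, so invariance of `T n` puts it in `T n` too.
    = U′⊥Tn (H∈U′ , resp (T n) (lower (U′⊆U H∈U′)) G∈Tn)

-- Vertices of degree two

-- The two neighbours are given as data, so that a path can be followed through `v`.
record DegreeTwo (G : Graph) (v : V G) : Set where
  open Graph G using (_≈_)
  field
    {a b} : V G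
    a≉b   : ¬ a ≈ b
    v~a   : Adj G v a
    v~b   : Adj G v b
    only  : ∀ {c} → Adj G v c → c ≈ a ⊎ c ≈ b

module _ {G : Graph} where
  open Graph G using (_≈_)
  open Setoid (vertices G) using () renaming (sym to ≈-sym; trans to ≈-trans; refl to ≈-refl)

  degreeTwo-resp : ∀ {u v} → u ≈ v → DegreeTwo G u → DegreeTwo G v
  degreeTwo-resp u≈v two = record
    { a≉b  = a≉b
    ; v~a  = Adj-respˡ G u≈v v~a
    ; v~b  = Adj-respˡ G u≈v v~b
    ; only = λ e → only (Adj-respˡ G (≈-sym u≈v) e)
    }
    where open DegreeTwo two

  three-neighbours : ∀ {v x y z} → Adj G v x → Adj G v y → Adj G v z →
                     ¬ x ≈ y → ¬ x ≈ z → ¬ y ≈ z → ¬ DegreeTwo G v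
  three-neighbours v~x v~y v~z x≉y x≉z y≉z two with only v~x | only v~y | only v~z
    where open DegreeTwo two
  ... | inj₁ p | inj₁ q | _      = x≉y (≈-trans p (≈-sym q))
  ... | inj₂ p | inj₂ q | _      = x≉y (≈-trans p (≈-sym q))
  ... | inj₁ p | inj₂ q | inj₁ r = x≉z (≈-trans p (≈-sym r))
  ... | inj₁ p | inj₂ q | inj₂ r = y≉z (≈-trans q (≈-sym r))
  ... | inj₂ p | inj₁ q | inj₁ r = y≉z (≈-trans q (≈-sym r))
  ... | inj₂ p | inj₁ q | inj₂ r = x≉z (≈-trans p (≈-sym r))

  -- A step without turning back: the path enters `b` from `a` and leaves by the other edge.
  record Continues (a b c : V G) : Set where
    field
      b~c  : Adj G b c
      c≉a  : ¬ c ≈ a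
      only : ∀ {k} → Adj G b k → k ≈ a ⊎ k ≈ c

  continue : ∀ {a b} → Adj G b a → DegreeTwo G b → ∃ (Continues a b)
  continue b~a two with only b~a
    where open DegreeTwo two
  ... | inj₁ a≈x = _ , record
    { b~c  = v~b
    ; c≉a  = λ y≈a → a≉b (≈-sym (≈-trans y≈a a≈x))
    ; only = λ e → [ (λ k≈x → inj₁ (≈-trans k≈x (≈-sym a≈x))) , inj₂ ]′ (only e)
    }
    where open DegreeTwo two
  ... | inj₂ a≈y = _ , record
    { b~c  = v~a
    ; c≉a  = λ x≈a → a≉b (≈-trans x≈a a≈y)
    ; only = λ e → [ inj₂ , (λ k≈y → inj₁ (≈-trans k≈y (≈-sym a≈y))) ]′ (only e)
    }
    where open DegreeTwo two

-- The partial isomorphism given by a pair of isomorphic balls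

module Correspondence {G H g h r} (ψ : ball r G g ≅• ball r H h) where
  private
    module G = Setoid (vertices G)
    module H = Setoid (vertices H)
    open Inverse (_≅_.bijection (_≅•_.iso ψ))
    adjacency = _≅_.adjacency (_≅•_.iso ψ)

  infix 4 _↔_
  -- The graph of the isomorphism as a relation on plain vertices, with the proof of membership in
  -- the first ball bundled in.
  _↔_ : V G → V H → Set
  x ↔ k = Σ[ dx ∈ Distance≤ G r g x ] proj₁ (to (x , dx)) H.≈ k

  abstract
    ↔-root : g ↔ h
    ↔-root = proj₂ (root (ball r G g)) , _≅•_.preserves ψ

    ↔-total : ∀ {x} → Distance≤ G r g x → ∃ (x ↔_)
    ↔-total dx = _ , dx , H.refl

    ↔-functional : ∀ {x x′ k k′} → x ↔ k → x′ ↔ k′ → x G.≈ x′ → k H.≈ k′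
    ↔-functional (_ , p) (_ , p′) x≈x′ = H.trans (H.sym p) (H.trans (to-cong x≈x′) p′)

    ↔-injective : ∀ {x x′ k k′} → x ↔ k → x′ ↔ k′ → k H.≈ k′ → x G.≈ x′
    ↔-injective (_ , p) (_ , p′) k≈k′ =
      G.trans (G.sym (strictlyInverseʳ _))
        (G.trans (from-cong (H.trans p (H.trans k≈k′ (H.sym p′)))) (strictlyInverseʳ _))

    ↔-adj : ∀ {x x′ k k′} → x ↔ k → x′ ↔ k′ → Adj G x x′ → Adj H k k′
    ↔-adj (_ , p) (_ , p′) e = Adj-respʳ H p′ (Adj-respˡ H p (⇒ (adjacency _ _) e))

    ↔-adj⁻¹ : ∀ {x x′ k k′} → x ↔ k → x′ ↔ k′ → Adj H k k′ → Adj G x x′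
    ↔-adj⁻¹ (_ , p) (_ , p′) e = ⇐ (adjacency _ _) (Adj-respʳ H (H.sym p′) (Adj-respˡ H (H.sym p) e))

    -- The walk to `x`, carried over to `H` and extended by one step, still has length at most `r`;
    -- hence `k′` lies in the ball and has a preimage.
    ↔-lift : ∀ {n x k k′} → Graph.Walk G n g x → suc n ≤ r → x ↔ k → Adj H k k′ →
             ∃[ x′ ] (Adj G x x′ × x′ ↔ k′)
    ↔-lift {n} {x} {k} {k′} p n<r x↔k e = _ , ↔-adj⁻¹ x↔k x′↔k′ e , x′↔k′
      where
      pᴴ : Graph.Walk H n h k
      -- The image walk starts at a vertex only equivalent to `h`; reversing twice allows the start
      -- to be replaced.
      pᴴ = Walk-respʳ (proj₂ x↔k)
        (reverseWalk (Walk-respʳ (_≅•_.preserves ψ) (reverseWalk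
          (mapWalk {H = H} (proj₁ ∘ to) to-cong (⇒ (adjacency _ _))
            (induced-walk (Graph.stop G.refl) (<⇒≤ n<r) p
              (proj₂ (root (ball r G g))) (proj₁ x↔k))))))
      x′↔k′ : proj₁ (from (k′ , suc n , n<r , snoc pᴴ e)) ↔ k′
      x′↔k′ = proj₂ (from (k′ , suc n , n<r , snoc pᴴ e)) , strictlyInverseˡ _

    -- Degrees are visible strictly inside the ball, where all neighbours on both sides are matched.
    ↔-degreeTwo⁻¹ : ∀ {n x k} → Graph.Walk G n g x → suc n ≤ r → x ↔ k →
                    DegreeTwo H k → DegreeTwo G x
    ↔-degreeTwo⁻¹ p n<r x↔k two
      with y , x~y , y↔a ← ↔-lift p n<r x↔k (DegreeTwo.v~a two)
      with z , x~z , z↔b ← ↔-lift p n<r x↔k (DegreeTwo.v~b two)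
      = record
      { a≉b  = λ y≈z → DegreeTwo.a≉b two (↔-functional y↔a z↔b y≈z)
      ; v~a  = x~y
      ; v~b  = x~z
      ; only = λ {w} x~w → let _ , w↔c = ↔-total (suc _ , n<r , snoc p x~w) in
          [ inj₁ ∘ ↔-injective w↔c y↔a , inj₂ ∘ ↔-injective w↔c z↔b ]′
            (DegreeTwo.only two (↔-adj x↔k w↔c x~w))
      }

    ↔-degreeTwo : ∀ {n x k} → Graph.Walk G n g x → suc n ≤ r → x ↔ k →
                  DegreeTwo G x → DegreeTwo H k
    ↔-degreeTwo p n<r x↔k two
      with _ , y↔a ← ↔-total (suc _ , n<r , snoc p (DegreeTwo.v~a two))
      with _ , z↔b ← ↔-total (suc _ , n<r , snoc p (DegreeTwo.v~b two))
      = record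
      { a≉b  = λ a≈b → DegreeTwo.a≉b two (↔-injective y↔a z↔b a≈b)
      ; v~a  = ↔-adj x↔k y↔a (DegreeTwo.v~a two)
      ; v~b  = ↔-adj x↔k z↔b (DegreeTwo.v~b two)
      ; only = λ k~c → let w , x~w , w↔c = ↔-lift p n<r x↔k k~c in
          [ inj₁ ∘ ↔-functional w↔c y↔a , inj₂ ∘ ↔-functional w↔c z↔b ]′
            (DegreeTwo.only two x~w)
      }

-- A finite core with a ray attached

record Core : Set₁ where
  infix 4 _~_
  field
    size     : ℕ
    _~_      : Rel (Fin size) 0ℓ
    ~-sym    : Symmetric _~_
    ~-irr    : ∀ {i} → ¬ i ~ i
    Attached : Pred (Fin size) 0ℓ

module WithRay (C : Core) where
  open Core C

  data Edge : Rel (Fin size ⊎ ℕ) 0ℓ where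
    core    : ∀ {i j} → i ~ j → Edge (inj₁ i) (inj₁ j)
    attach  : ∀ {i} → Attached i → Edge (inj₁ i) (inj₂ 0)
    attach⁻ : ∀ {i} → Attached i → Edge (inj₂ 0) (inj₁ i)
    up      : ∀ {n} → Edge (inj₂ n) (inj₂ (suc n))
    down    : ∀ {n} → Edge (inj₂ (suc n)) (inj₂ n)

  Edge-sym : Symmetric Edge
  Edge-sym (core e)    = core (~-sym e)
  Edge-sym (attach a)  = attach⁻ a
  Edge-sym (attach⁻ a) = attach a
  Edge-sym up          = down
  Edge-sym down        = up

  withRay : Graph
  withRay = record
    { vertices = setoid (Fin size ⊎ ℕ)
    ; Adj      = Edge
    ; Adj-resp = (λ { refl e → e }) , (λ { refl e → e })
    ; Adj-sym  = Edge-sym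
    ; Adj-irr  = λ { refl (core e) → ~-irr e }
    }

  ray-degreeTwo : ∀ n → DegreeTwo withRay (inj₂ (suc n))
  ray-degreeTwo n = record
    { a≉b  = λ ()
    ; v~a  = down
    ; v~b  = up
    ; only = λ { down → inj₁ refl ; up → inj₂ refl }
    }

  open Graph withRay using (Walk)

  ray-walk : ∀ n → Walk n (inj₂ n) (inj₂ 0)
  ray-walk zero    = Graph.stop refl
  ray-walk (suc n) = Graph.step down (ray-walk n)

  -- Degree two singles out the ray beyond its start, and distance 2 puts the core strictly inside
  -- every ball of radius at least 3 around the start.
  record Rigid : Set where
    field
      core-not-two  : ∀ i → ¬ DegreeTwo withRay (inj₁ i)
      start-not-two : ¬ DegreeTwo withRay (inj₂ 0)
      core-near     : ∀ i → Distance≤ withRay 2 (inj₂ 0) (inj₁ i)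

  -- Reconstruction from the balls

  module Reconstruction
    (rigid : Rigid) {H : Graph} (connected : Graph.Connected H) (infinite : Graph.Infinite H)
    {r} (3≤r : 3 ≤ r) (G≐H : 𝔅 r withRay ≐ 𝔅 r H) where

    open Rigid rigid
    open Graph H using (_≈_)
    open Setoid (vertices H) using () renaming (sym to ≈-sym; trans to ≈-trans; refl to ≈-refl)

    1≤r : 1 ≤ r
    1≤r = ≤-trans (s≤s z≤n) 3≤r

    2≤r : 2 ≤ r
    2≤r = ≤-trans (s≤s (s≤s z≤n)) 3≤r

    core-walk : ∀ i → Walk (proj₁ (core-near i)) (inj₂ 0) (inj₁ i)
    core-walk i = proj₂ (proj₂ (core-near i))

    core-inside : ∀ i → proj₁ (core-near i) < r
    core-inside i = ≤-trans (s≤s (proj₁ (proj₂ (core-near i)))) 3≤r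

    -- The degree-two vertices are the ray beyond its start, so only one edge enters them from
    -- outside. This locates the end of a path of degree-two vertices.
    start-edge : ∀ {x y} → Edge x y → ¬ DegreeTwo withRay x → DegreeTwo withRay y →
                 x ≡ inj₂ 0 × y ≡ inj₂ 1
    start-edge (core _)     ¬x y = contradiction y (core-not-two _)
    start-edge (attach _)   ¬x y = contradiction y start-not-two
    start-edge (attach⁻ _)  ¬x y = contradiction y (core-not-two _)
    start-edge (up {zero})  ¬x y = refl , refl
    start-edge (up {suc n}) ¬x y = contradiction (ray-degreeTwo n) ¬x
    start-edge (down {n})   ¬x y = contradiction (ray-degreeTwo n) ¬x

    h₀ : V H
    h₀ = proj₁ (proj₁ G≐H (inj₂ 0 , ≅•-refl))

    ψ₀ : ball r withRay (inj₂ 0) ≅• ball r H h₀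
    ψ₀ = proj₂ (proj₁ G≐H (inj₂ 0 , ≅•-refl))

    open Correspondence ψ₀

    -- The ball at `k` occurs in `withRay`, and the position of its centre there settles the degree.
    -- The second case keeps the isomorphism for use at the end of a path.
    classify : ∀ k → DegreeTwo H k ⊎
               ∃[ g ] (¬ DegreeTwo withRay g × ball r withRay g ≅• ball r H k)
    classify k with proj₂ G≐H (k , ≅•-refl)
    ... | inj₁ i , φ       = inj₂ (inj₁ i , core-not-two i , ≅•-sym φ)
    ... | inj₂ 0 , φ       = inj₂ (inj₂ 0 , start-not-two , ≅•-sym φ)
    ... | inj₂ (suc n) , φ = inj₁ (K.↔-degreeTwo (Graph.stop refl) 1≤r K.↔-root (ray-degreeTwo n))
      where module K = Correspondence (≅•-sym φ)

    -- The second case never occurs along the path p below (p-two); its value only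
    -- makes the recursion total.
    next : ∀ {a b} → Adj H b a → ∃[ c ] Adj H c b
    next {a} {b} b~a with classify b
    ... | inj₁ two = let c , ext = continue b~a two in c , Graph.Adj-sym H (Continues.b~c ext)
    ... | inj₂ _   = a , Graph.Adj-sym H b~a

    next-continues : ∀ {a b} (b~a : Adj H b a) → DegreeTwo H b → Continues a b (proj₁ (next b~a))
    next-continues {a} {b} b~a two with classify b
    ... | inj₁ two′           = proj₂ (continue b~a two′)
    ... | inj₂ (g , ¬two , ψ) = contradiction
      (K.↔-degreeTwo⁻¹ (Graph.stop refl) 1≤r K.↔-root two) ¬two
      where module K = Correspondence ψ

    abstract
      e↔ : ∀ i → ∃ (inj₁ i ↔_)
      e↔ i = ↔-total (_ , <⇒≤ (core-inside i) , core-walk i)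

    e : Fin size → V H
    e i = proj₁ (e↔ i)

    abstract
      h₁↔ : ∃ (inj₂ 1 ↔_)
      h₁↔ = ↔-total (1 , ≤-trans (s≤s z≤n) 3≤r , Graph.step up (Graph.stop refl))

    -- The state is an edge, since going on from `b` without turning back requires the previous
    -- vertex `a`.
    edges : ℕ → Σ[ a ∈ V H ] Σ[ b ∈ V H ] Adj H b a
    edges zero    = h₀ , proj₁ h₁↔ , ↔-adj (proj₂ h₁↔) ↔-root down
    edges (suc n) = let _ , b , b~a = edges n in b , next b~a

    p : ℕ → V H
    p n = proj₁ (edges n)

    p-adj : ∀ n → Adj H (p (suc n)) (p n)
    p-adj n = proj₂ (proj₂ (edges n))

    p-continues : ∀ n → DegreeTwo H (p (suc n)) → Continues (p n) (p (suc n)) (p (suc (suc n)))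
    p-continues n = next-continues (p-adj n)

    p₁-two : DegreeTwo H (p 1)
    p₁-two = ↔-degreeTwo (Graph.step up (Graph.stop refl)) 2≤r
               (proj₂ h₁↔) (ray-degreeTwo 0)

    -- A neighbour of a core vertex or of the start of the ray is again near the
    -- start of the ray, where ψ₀ controls it.
    e-neighbour : ∀ i {k} → Adj H (e i) k →
                  ∃[ x ] (Edge (inj₁ i) x × [ e , p ]′ x ≈ k)
    e-neighbour i e~k with ↔-lift (core-walk i) (core-inside i) (proj₂ (e↔ i)) e~k
    ... | inj₁ j , i~j , j↔k = inj₁ j , i~j , ↔-functional (proj₂ (e↔ j)) j↔k refl
    ... | inj₂ 0 , i~0 , 0↔k = inj₂ 0 , i~0 , ↔-functional ↔-root 0↔k refl

    p₀-neighbour : ∀ {k} → Adj H (p 0) k → ∃[ x ] (Edge (inj₂ 0) x × [ e , p ]′ x ≈ k)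
    p₀-neighbour 0~k with ↔-lift (Graph.stop refl) 1≤r ↔-root 0~k
    ... | inj₁ j , 0~j , j↔k = inj₁ j , 0~j , ↔-functional (proj₂ (e↔ j)) j↔k refl
    ... | inj₂ 1 , 0~1 , 1↔k = inj₂ 1 , 0~1 , ↔-functional (proj₂ h₁↔) 1↔k refl

    -- A path that ends makes `H` finite

    module _ {n g} (two : ∀ {i} → i ≤ n → DegreeTwo H (p (suc i)))
             (¬two : ¬ DegreeTwo withRay g) (ψ : ball r withRay g ≅• ball r H (p (suc (suc n)))) where
      private
        module K = Correspondence ψ

        q : V H
        q = p (suc (suc n))

        -- Read backwards from `q`, the last step of the path leads from `g` to a vertex of degree
        -- two, and `start-edge` leaves one possibility.
        start-matched : g ≡ inj₂ 0 × inj₂ 0 K.↔ q × inj₂ 1 K.↔ p (suc n)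
        start-matched
          with y , g~y , y↔pn ← K.↔-lift (Graph.stop refl) 1≤r K.↔-root (p-adj (suc n))
          with refl , refl ← start-edge g~y ¬two
            (K.↔-degreeTwo⁻¹ (Graph.step g~y (Graph.stop refl)) 2≤r y↔pn (two ≤-refl))
          = refl , K.↔-root , y↔pn

        g≡0 : g ≡ inj₂ 0
        g≡0 = proj₁ start-matched

        0↔q : inj₂ 0 K.↔ q
        0↔q = proj₁ (proj₂ start-matched)

        1↔pn : inj₂ 1 K.↔ p (suc n)
        1↔pn = proj₂ (proj₂ start-matched)

        walk-from-start : ∀ {m x} → Graph.Walk withRay m (inj₂ 0) x → Graph.Walk withRay m g x
        walk-from-start {m} {x} = subst (λ y → Graph.Walk withRay m y x) (sym g≡0)

        abstract
          e′↔ : ∀ i → ∃ (inj₁ i K.↔_)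
          e′↔ i = K.↔-total (_ , <⇒≤ (core-inside i) , walk-from-start (core-walk i))

        e′ : Fin size → V H
        e′ i = proj₁ (e′↔ i)

        -- The copy of the core at p 0, the path from p 0 to q, and the copy of the
        -- core at q exhaust the vertices.
        data Listed (v : V H) : Set where
          in-core  : ∀ i → e i ≈ v → Listed v
          on-path  : ∀ m → m ≤ suc (suc n) → p m ≈ v → Listed v
          in-core′ : ∀ i → e′ i ≈ v → Listed v

        -- Ray vertices from `inj₂ 2` on have only neighbours of degree two, so `x` is in the core
        -- or one of the first two ray vertices.
        near-listed : ∀ {x v} → [ e , p ]′ x ≈ v → ∀ {y} → Edge y x → ¬ DegreeTwo withRay y → Listed v
        near-listed {inj₁ i}             q _    _    = in-core i q
        near-listed {inj₂ zero}          q _    _    = on-path 0 z≤n q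
        near-listed {inj₂ (suc zero)}    q _    _    = on-path 1 (s≤s z≤n) q
        near-listed {inj₂ (suc (suc m))} _ up   ¬two = contradiction (ray-degreeTwo m) ¬two
        near-listed {inj₂ (suc (suc m))} _ down ¬two = contradiction (ray-degreeTwo (suc (suc m))) ¬two

        listed-resp : ∀ {u v} → u ≈ v → Listed u → Listed v
        listed-resp u≈v (in-core i q)    = in-core i (≈-trans q u≈v)
        listed-resp u≈v (on-path m m≤ q) = on-path m m≤ (≈-trans q u≈v)
        listed-resp u≈v (in-core′ i q)   = in-core′ i (≈-trans q u≈v)

        core-listed : ∀ {i v} → ∃[ x ] (Edge (inj₁ i) x × x K.↔ v) → Listed v
        core-listed (inj₁ j , _ , j↔v) = in-core′ j (K.↔-functional (proj₂ (e′↔ j)) j↔v refl)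
        core-listed (inj₂ 0 , _ , 0↔v) =
          on-path (suc (suc n)) ≤-refl (K.↔-functional 0↔q 0↔v refl)

        start-listed : ∀ {v} → ∃[ x ] (Edge (inj₂ 0) x × x K.↔ v) → Listed v
        start-listed (inj₁ j , _ , j↔v) = in-core′ j (K.↔-functional (proj₂ (e′↔ j)) j↔v refl)
        start-listed (inj₂ 1 , _ , 1↔v) =
          on-path (suc n) (n≤1+n (suc n)) (K.↔-functional 1↔pn 1↔v refl)

        path-listed : ∀ {m} → m ≤ suc (suc n) → ∀ {v} → Adj H (p m) v → Listed v
        path-listed {zero} _ 0~v =
          let x , 0~x , x≈v = p₀-neighbour 0~v in near-listed x≈v 0~x start-not-two
        path-listed {suc m} (s≤s m≤1+n) m~v with m≤n⇒m<n∨m≡n m≤1+n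
        ... | inj₁ (s≤s m≤n) =
          [ (λ v≈p → on-path m (≤-trans m≤n (m≤n+m n 2)) (≈-sym v≈p))
          , (λ v≈p → on-path (suc (suc m)) (s≤s (s≤s m≤n)) (≈-sym v≈p))
          ]′ (Continues.only (p-continues m (two m≤n)) m~v)
        -- Here `p (suc m)` is `q`, whose neighbours are read off its own ball.
        ... | inj₂ refl = start-listed
          (K.↔-lift (walk-from-start (Graph.stop refl)) 1≤r 0↔q m~v)

        listed-closed : ∀ {u v} → Adj H u v → Listed u → Listed v
        listed-closed u~v (in-core i ei≈u) =
          let x , i~x , x≈v = e-neighbour i (Adj-respˡ H (≈-sym ei≈u) u~v) in
          near-listed x≈v i~x (core-not-two i)
        listed-closed u~v (on-path m m≤2+n pm≈u) =
          path-listed m≤2+n (Adj-respˡ H (≈-sym pm≈u) u~v)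
        listed-closed u~v (in-core′ i ei≈u) = core-listed
          (K.↔-lift (walk-from-start (core-walk i)) (core-inside i)
            (proj₂ (e′↔ i)) (Adj-respˡ H (≈-sym ei≈u) u~v))

        vertexList : List (V H)
        -- `upTo` excludes its bound, and the index of `q` is `suc (suc n)`.
        vertexList = map e (allFin _) ++ map p (upTo (suc (suc (suc n)))) ++ map e′ (allFin _)

        open Membership (vertices H) using (_∈_)

        ∈-image : ∀ {A : Set} (f : A → V H) {xs x v} →
                  Membership._∈_ (setoid A) x xs → f x ≈ v → v ∈ map f xs
        ∈-image f x∈xs fx≈v = Any.map⁺ (Any.map (λ { refl → ≈-sym fx≈v }) x∈xs)

        listed⇒∈ : ∀ {v} → Listed v → v ∈ vertexList
        listed⇒∈ (in-core i q) = Any.++⁺ˡ (∈-image e (∈-allFin i) q)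
        listed⇒∈ (on-path m m≤ q) =
          Any.++⁺ʳ (map e (allFin _)) (Any.++⁺ˡ (∈-image p (∈-upTo⁺ (s≤s m≤)) q))
        listed⇒∈ (in-core′ i q) =
          Any.++⁺ʳ (map e (allFin _)) (Any.++⁺ʳ (map p (upTo _)) (∈-image e′ (∈-allFin i) q))

      -- `Listed` holds at `p 0` and is closed under adjacency, so connectedness makes a finite list
      -- exhaust `H`.
      end-impossible : ⊥
      end-impossible = infinite (list⇒finite {G = H} vertexList λ v →
        listed⇒∈ (walk-closed Listed listed-resp listed-closed (proj₂ (connected (p 0) v))
          (on-path 0 z≤n ≈-refl)))

    p-two : ∀ n → DegreeTwo H (p (suc n))
    p-two n = up-to n ≤-refl
      where
      -- All indices up to `n` are carried along, because `end-impossible` asks for degree two on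
      -- the whole path before its end.
      up-to : ∀ n {i} → i ≤ n → DegreeTwo H (p (suc i))
      up-to zero    z≤n   = p₁-two
      up-to (suc n) i≤1+n with m≤n⇒m<n∨m≡n i≤1+n
      ... | inj₁ (s≤s i≤n) = up-to n i≤n
      ... | inj₂ refl with classify (p (suc (suc n)))
      ...   | inj₁ two            = two
      ...   | inj₂ (g , ¬two , ψ) = ⊥-elim (end-impossible (λ {i} → up-to n {i}) ¬two ψ)

    -- The isomorphism onto `H`

    F : Fin size ⊎ ℕ → V H
    F = [ e , p ]′

    F-adj : ∀ {x y} → Edge x y → Adj H (F x) (F y)
    F-adj (core {i} {j} i~j) = ↔-adj (proj₂ (e↔ i)) (proj₂ (e↔ j)) (core i~j)
    F-adj (attach {i} a)     = ↔-adj (proj₂ (e↔ i)) ↔-root (attach a)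
    F-adj (attach⁻ {i} a)    = ↔-adj ↔-root (proj₂ (e↔ i)) (attach⁻ a)
    F-adj (up {n})           = Graph.Adj-sym H (p-adj n)
    F-adj (down {n})         = p-adj n

    -- Lifting of neighbours yields surjectivity by connectedness and, with injectivity, reflection
    -- of adjacency.
    F-neighbour : ∀ x {k} → Adj H (F x) k → ∃[ y ] (Edge x y × F y ≈ k)
    F-neighbour (inj₁ i)       = e-neighbour i
    F-neighbour (inj₂ zero)    = p₀-neighbour
    F-neighbour (inj₂ (suc n)) x~k with Continues.only (p-continues n (p-two n)) x~k
    ... | inj₁ k≈p = inj₂ n , down , ≈-sym k≈p
    ... | inj₂ k≈p = inj₂ (suc (suc n)) , up , ≈-sym k≈p

    e-not-two : ∀ i → ¬ DegreeTwo H (e i)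
    e-not-two i two = core-not-two i
      (↔-degreeTwo⁻¹ (core-walk i) (core-inside i) (proj₂ (e↔ i)) two)

    p₀-not-two : ¬ DegreeTwo H (p 0)
    p₀-not-two two = start-not-two
      (↔-degreeTwo⁻¹ (Graph.stop refl) 1≤r ↔-root two)

    e≉p : ∀ i n → ¬ e i ≈ p n
    e≉p i zero q with () ← ↔-injective (proj₂ (e↔ i)) ↔-root q
    e≉p i (suc n) q = e-not-two i (degreeTwo-resp (≈-sym q) (p-two n))

    p-injective : ∀ n m → p n ≈ p m → n ≡ m
    p-injective zero    zero    q = refl
    p-injective zero    (suc m) q = contradiction (degreeTwo-resp (≈-sym q) (p-two m)) p₀-not-two
    p-injective (suc n) zero    q = contradiction (degreeTwo-resp q (p-two n)) p₀-not-two
    p-injective (suc n) (suc m) q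
      with Continues.only (p-continues m (p-two m)) (Adj-respˡ H q (p-adj n))
    ... | inj₁ pn≈pm = cong suc (p-injective n m pn≈pm)
    -- The recursive call decreases the first index. It gives `n = m + 2`, so `q` identifies
    -- `p (m + 3)` with `p (m + 1)`: the path would turn back.
    ... | inj₂ pn≈p with refl ← p-injective n (suc (suc m)) pn≈p =
      contradiction q (Continues.c≉a (p-continues (suc m) (p-two (suc m))))

    F-injective : ∀ x y → F x ≈ F y → x ≡ y
    F-injective (inj₁ i) (inj₁ j) q = ↔-injective (proj₂ (e↔ i)) (proj₂ (e↔ j)) q
    F-injective (inj₁ i) (inj₂ n) q = contradiction q (e≉p i n)
    F-injective (inj₂ n) (inj₁ i) q = contradiction (≈-sym q) (e≉p i n)
    F-injective (inj₂ n) (inj₂ m) q = cong inj₂ (p-injective n m q)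

    F-surjective : ∀ k → ∃[ x ] F x ≈ k
    F-surjective k = walk-closed (λ k → ∃[ x ] F x ≈ k)
      (λ u≈v (x , q) → x , ≈-trans q u≈v)
      (λ u~v (x , q) → let y , _ , q′ = F-neighbour x (Adj-respˡ H (≈-sym q) u~v) in y , q′)
      (proj₂ (connected (p 0) k)) (inj₂ 0 , ≈-refl)

    reconstruct : withRay ≅ H
    reconstruct = record
      { bijection = record
        { to        = F
        ; from      = λ k → proj₁ (F-surjective k)
        ; to-cong   = λ { refl → ≈-refl }
        ; from-cong = λ k≈l → F-injective _ _
            (≈-trans (proj₂ (F-surjective _)) (≈-trans k≈l (≈-sym (proj₂ (F-surjective _)))))
        ; inverse   = (λ { refl → proj₂ (F-surjective _) }) ,
                      (λ k≈Fx → F-injective _ _ (≈-trans (proj₂ (F-surjective _)) k≈Fx))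
        }
      ; adjacency = λ x y → mk⇔ F-adj λ Fx~Fy →
          let z , x~z , Fz≈Fy = F-neighbour x Fx~Fy in
          subst (Edge x) (F-injective z y Fz≈Fy) x~z
      }

-- The core with its ray as an isolated point

module _ (C : Core) where
  open Core C
  open WithRay C

  withRay-infinite : Graph.Infinite withRay
  withRay-infinite (n , onto) = Fin.ℕ→Fin-notInjective index index-injective
    where
    open Surjection onto
    index : ℕ → Fin n
    index m = proj₁ (surjective (inj₂ m))
    index-injective : Injective _≡_ _≡_ index
    index-injective {k} {l} eq = inj₂-injective
      (trans (sym (proj₂ (surjective (inj₂ k)) refl)) (proj₂ (surjective (inj₂ l)) eq))

  module _ (rigid : Rigid) where
    open Rigid rigid

    to-start : ∀ u → ∃[ n ] Graph.Walk withRay n u (inj₂ 0)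
    to-start (inj₁ i) = _ , reverseWalk (proj₂ (proj₂ (core-near i)))
    to-start (inj₂ n) = n , ray-walk n

    withRay-connected : Graph.Connected withRay
    withRay-connected u v = proj₂ (to-start u) ++ʷ reverseWalk (proj₂ (to-start v))

    module _ {D} (maxDegree : Graph.MaxDegree≤ withRay D) where

      infiniteGraph : InfiniteGraph D
      infiniteGraph = record
        { underlying = withRay
        ; connected  = withRay-connected
        ; infinite   = withRay-infinite
        ; maxDegree  = maxDegree
        }

      infiniteGraph-isolated : Isolated infiniteGraph
      infiniteGraph-isolated = 3 , λ H 3≤r G≐H →
        Reconstruction.reconstruct rigid (connected H) (infinite H) 3≤r G≐H

-- Parity of a perfect matching

-- If `y` were missed, an extra point sent to `y` would extend `f` to an injection of `Fin (suc n)`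
-- into `Fin n`.
injective⇒surjective : ∀ {n} (f : Fin n → Fin n) → Injective _≡_ _≡_ f → ∀ y → ∃[ x ] f x ≡ y
injective⇒surjective {n} f f-inj y with Fin.any? (λ x → f x Fin.≟ y)
... | yes found = found
... | no missed = ⊥-elim (Fin.<⇒notInjective (n<1+n n) g-inj)
  where
  g : Fin (suc n) → Fin n
  g zero    = y
  g (suc x) = f x
  g-inj : Injective _≡_ _≡_ g
  g-inj {zero}  {zero}  eq = refl
  g-inj {zero}  {suc x} eq = contradiction (x , sym eq) missed
  g-inj {suc x} {zero}  eq = contradiction (x , eq) missed
  g-inj {suc x} {suc z} eq = cong suc (f-inj eq)

less : ∀ {n} → Fin n → Fin n → ℕ
less i j = if does (i Fin.<? j) then 1 else 0

less-connex : ∀ {n} {i j : Fin n} → i ≢ j → less i j + less j i ≡ 1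
less-connex {i = i} {j} i≢j with Fin.<-cmp i j
... | tri< i<j _ i≯j rewrite dec-true (i Fin.<? j) i<j | dec-false (j Fin.<? i) i≯j = refl
... | tri≈ _ i≡j _   = contradiction i≡j i≢j
... | tri> i≮j _ i>j rewrite dec-false (i Fin.<? j) i≮j | dec-true (j Fin.<? i) i>j = refl

sum-ones : ∀ n → Sum.sum {n} (λ _ → 1) ≡ n
sum-ones zero    = refl
sum-ones (suc n) = cong suc (sum-ones n)

-- An involution exchanges the points it moves up with the points it moves down.
fixed-point-free⇒even : ∀ {n} (f : Fin n → Fin n) → (∀ i → f (f i) ≡ i) → (∀ i → f i ≢ i) →
                        ∃[ k ] n ≡ 2 * k
fixed-point-free⇒even {n} f invol fpf = Sum.sum raised , (begin
  n                                        ≡⟨ sum-ones n ⟨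
  Sum.sum {n} (λ _ → 1)                    ≡⟨ Sum.sum-cong-≗ (λ i → less-connex (fpf i ∘ sym)) ⟨
  Sum.sum (λ i → raised i + less (f i) i)  ≡⟨ Sum.∑-distrib-+ raised (λ i → less (f i) i) ⟩
  Sum.sum raised + Sum.sum (λ i → less (f i) i)
    ≡⟨ cong (Sum.sum raised +_) (Sum.sum-cong-≗ (λ i → cong (less (f i)) (invol i))) ⟨
  Sum.sum raised + Sum.sum (raised ∘ f)
    ≡⟨ cong (Sum.sum raised +_) (Sum.sum-permute raised (permutation f f invol invol)) ⟨
  Sum.sum raised + Sum.sum raised          ≡⟨ cong (Sum.sum raised +_) (+-identityʳ _) ⟨
  2 * Sum.sum raised                       ∎)
  where
  open ≡-Reasoning
  raised : Fin n → ℕ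
  raised i = less i (f i)

module _ {D G} (c : EdgeColouring D G) (_≟ᵛ_ : ∀ u v → Dec (Graph._≈_ G u v)) where
  open EdgeColouring c
  open Graph G using (_≈_)

  -- Properness leaves at most one edge of colour `γ` at each vertex, so passing to its other end is
  -- an involution; it has no fixed point because there are no loops.
  colour-class⇒even : ∀ {n} (ι : Fin n → V G) → Injective _≡_ _≈_ ι → ∀ γ →
    (∀ i → ∃[ j ] Σ[ e ∈ Adj G (ι i) (ι j) ] colour e ≡ γ) → ∃[ k ] n ≡ 2 * k
  colour-class⇒even ι ι-inj γ mate = fixed-point-free⇒even f invol fpf
    where
    f : Fin _ → Fin _
    f i = proj₁ (mate i)
    invol : ∀ i → f (f i) ≡ i
    -- `proper` only refutes inequivalence; decidability turns this into equivalence.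
    invol i = ι-inj (decidable-stable (_ ≟ᵛ _) λ ffi≉i →
      proper (proj₁ (proj₂ (mate (f i)))) (Graph.Adj-sym G (proj₁ (proj₂ (mate i)))) ffi≉i
        (trans (proj₂ (proj₂ (mate (f i))))
          (trans (sym (proj₂ (proj₂ (mate i)))) (unoriented _ _))))
    fpf : ∀ i → f i ≢ i
    fpf i fi≡i = Graph.Adj-irr G (Setoid.reflexive (vertices G) (cong ι (sym fi≡i)))
      (proj₁ (proj₂ (mate i)))

-- The two isolated points

emptyCore : Core
emptyCore = record
  { size = 0 ; _~_ = λ _ _ → ⊥ ; ~-sym = λ () ; ~-irr = λ () ; Attached = λ _ → ⊥ }

module Ray where
  open WithRay emptyCore public renaming (withRay to ray)

  rigid : Rigid
  rigid = record
    { core-not-two  = λ ()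
    ; start-not-two = λ two → DegreeTwo.a≉b two
        (trans (start-neighbour (DegreeTwo.v~a two)) (sym (start-neighbour (DegreeTwo.v~b two))))
    ; core-near     = λ ()
    }
    where
    start-neighbour : ∀ {x} → Edge (inj₂ 0) x → x ≡ inj₂ 1
    start-neighbour up = refl

  maxDegree≤ : ∀ {D} → 2 ≤ D → Graph.MaxDegree≤ ray D
  maxDegree≤ 2≤D (inj₂ zero)    = inj₂ 1 ∷ [] , ≤-trans (s≤s z≤n) 2≤D , λ { up → here refl }
  maxDegree≤ 2≤D (inj₂ (suc n)) = inj₂ n ∷ inj₂ (suc (suc n)) ∷ [] , 2≤D ,
    λ { down → here refl ; up → there (here refl) }

  module _ {D : ℕ} where
    parity : ℕ → Fin (suc (suc D))
    parity zero          = zero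
    parity (suc zero)    = suc zero
    parity (suc (suc n)) = parity n

    parity-alternates : ∀ n → parity n ≢ parity (suc n)
    parity-alternates zero    ()
    parity-alternates (suc n) eq = parity-alternates n (sym eq)

    edgeColour : ∀ {u v} → Edge u v → Fin (suc (suc D))
    edgeColour (up {n})   = parity n
    edgeColour (down {n}) = parity n

    edgeColouring : EdgeColouring (suc (suc D)) ray
    edgeColouring = record
      { colour       = edgeColour
      ; well-defined = λ
        { up   up   refl refl → refl
        ; down down refl refl → refl
        }
      ; unoriented   = λ { up down → refl ; down up → refl }
      ; proper       = λ
        { up   up   v≉w → contradiction refl v≉w
        ; down down v≉w → contradiction refl v≉w
        ; (up {suc n}) down _ → parity-alternates n ∘ sym
        ; down (up {suc n}) _ → parity-alternates n
        }
      }

-- The complete graph on D + 1 = d + 4 vertices without the edge 01; the start of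
-- the ray, attached to 0 and 1, subdivides the missing edge.
module Subdivided (d : ℕ) where
  D : ℕ
  D = suc (suc (suc d))

  subdivided : Core
  subdivided = record
    { size     = suc D
    -- Some end lies outside `{0, 1}`, which excludes just the edge 01.
    ; _~_      = λ i j → i ≢ j × (2 ≤ toℕ i ⊎ 2 ≤ toℕ j)
    ; ~-sym    = λ (i≢j , p) → i≢j ∘ sym , swap p
    ; ~-irr    = λ (i≢i , _) → i≢i refl
    ; Attached = λ i → toℕ i < 2
    }

  open WithRay subdivided public

  -- Enumerates the `D` neighbours of a core vertex; for 0 and 1, the start of the ray stands in for
  -- the other one.
  slot : Fin (suc D) → Fin D → Fin (suc D) ⊎ ℕ
  slot zero          zero    = inj₂ 0
  slot zero          (suc j) = inj₁ (suc (suc j))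
  slot (suc zero)    zero    = inj₂ 0
  slot (suc zero)    (suc j) = inj₁ (suc (suc j))
  slot (suc (suc i)) j       = inj₁ (punchIn (suc (suc i)) j)

  slot-adj : ∀ i j → Edge (inj₁ i) (slot i j)
  slot-adj zero          zero    = attach (s≤s z≤n)
  slot-adj zero          (suc j) = core ((λ ()) , inj₂ (s≤s (s≤s z≤n)))
  slot-adj (suc zero)    zero    = attach (s≤s (s≤s z≤n))
  slot-adj (suc zero)    (suc j) = core ((λ ()) , inj₂ (s≤s (s≤s z≤n)))
  slot-adj (suc (suc i)) j       =
    core (Fin.punchInᵢ≢i (suc (suc i)) j ∘ sym , inj₁ (s≤s (s≤s z≤n)))

  slot-injective : ∀ i → Injective _≡_ _≡_ (slot i)
  slot-injective zero          {zero}  {zero}  _    = refl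
  slot-injective zero          {suc _} {suc _} refl = refl
  slot-injective (suc zero)    {zero}  {zero}  _    = refl
  slot-injective (suc zero)    {suc _} {suc _} refl = refl
  slot-injective (suc (suc i)) eq = Fin.punchIn-injective (suc (suc i)) _ _ (inj₁-injective eq)

  slot-surjective : ∀ i {x} → Edge (inj₁ i) x → ∃[ j ] x ≡ slot i j
  slot-surjective zero       (core {j = zero}        (i≢j , _)) = contradiction refl i≢j
  slot-surjective zero       (core {j = suc zero}    (_ , inj₂ (s≤s ())))
  slot-surjective zero       (core {j = suc (suc j)} _)         = suc j , refl
  slot-surjective zero       (attach _)                         = zero , refl
  slot-surjective (suc zero) (core {j = zero}        (_ , inj₁ (s≤s ())))
  slot-surjective (suc zero) (core {j = suc zero}    (i≢j , _)) = contradiction refl i≢j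
  slot-surjective (suc zero) (core {j = suc (suc j)} _)         = suc j , refl
  slot-surjective (suc zero) (attach _)                         = zero , refl
  slot-surjective (suc (suc i)) (core (i≢j , _)) =
    punchOut i≢j , cong inj₁ (sym (Fin.punchIn-punchOut i≢j))
  slot-surjective (suc (suc i)) (attach (s≤s (s≤s ())))

  maxDegree≤ : Graph.MaxDegree≤ withRay D
  maxDegree≤ (inj₁ i) = tabulate (slot i) , ≤-reflexive (length-tabulate (slot i)) ,
    λ i~x → let j , x≡slot = slot-surjective i i~x in Any.tabulate⁺ {f = slot i} j x≡slot
  maxDegree≤ (inj₂ zero) =
    inj₁ zero ∷ inj₁ (suc zero) ∷ inj₂ 1 ∷ [] , s≤s (s≤s (s≤s z≤n)) , λ
      { (attach⁻ {zero} _)           → here refl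
      ; (attach⁻ {suc zero} _)       → there (here refl)
      ; (attach⁻ {suc (suc _)} (s≤s (s≤s ())))
      ; up                           → there (there (here refl))
      }
  maxDegree≤ (inj₂ (suc n)) = inj₂ n ∷ inj₂ (suc (suc n)) ∷ [] , s≤s (s≤s z≤n) ,
    λ { down → here refl ; up → there (here refl) }

  start~0 : Edge (inj₂ 0) (inj₁ zero)
  start~0 = attach⁻ (s≤s z≤n)

  start~1 : Edge (inj₂ 0) (inj₁ (suc zero))
  start~1 = attach⁻ (s≤s (s≤s z≤n))

  rigid : Rigid
  rigid = record
    -- As `D` is at least 3, there are three distinct slots.
    { core-not-two  = λ i → three-neighbours
        (slot-adj i zero) (slot-adj i (suc zero)) (slot-adj i (suc (suc zero)))
        ((λ ()) ∘ slot-injective i) ((λ ()) ∘ slot-injective i) ((λ ()) ∘ slot-injective i)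
    ; start-not-two = three-neighbours start~0 start~1 up (λ ()) (λ ()) (λ ())
    ; core-near     = λ
      { zero          → 1 , s≤s z≤n , Graph.step start~0 (Graph.stop refl)
      ; (suc zero)    → 1 , s≤s z≤n , Graph.step start~1 (Graph.stop refl)
      ; (suc (suc i)) → 2 , ≤-refl ,
          Graph.step start~0 (Graph.step (core ((λ ()) , inj₂ (s≤s (s≤s z≤n)))) (Graph.stop refl))
      }
    }

  module _ (c : EdgeColouring D withRay) where
    open EdgeColouring c

    -- The `D` edges at a core vertex have distinct colours, so all `D` colours occur.
    incident : ∀ i γ → ∃[ x ] Σ[ e ∈ Edge (inj₁ i) x ] colour e ≡ γ
    incident i γ = let j , eq = injective⇒surjective (colour ∘ slot-adj i) colour-injective γ in
      slot i j , slot-adj i j , eq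
      where
      colour-injective : Injective _≡_ _≡_ (colour ∘ slot-adj i)
      colour-injective {j} {k} eq = decidable-stable (j Fin.≟ k) λ j≢k →
        proper (slot-adj i j) (slot-adj i k) (j≢k ∘ slot-injective i) eq

    _≟ᵛ_ : (u v : Fin (suc D) ⊎ ℕ) → Dec (u ≡ v)
    _≟ᵛ_ = ≡-dec Fin._≟_ _≟_

    -- The colour of the first ray edge matches the core perfectly; the colour of
    -- an edge attaching the core matches the core together with the start of the ray.
    core-even : ∃[ k ] suc D ≡ 2 * k
    core-even = colour-class⇒even c _≟ᵛ_ inj₁ inj₁-injective (colour up) mate
      where
      mate : ∀ i → ∃[ j ] Σ[ e ∈ Edge (inj₁ i) (inj₁ j) ] colour e ≡ colour (up {0})
      mate i with incident i (colour up)
      ... | inj₁ j , e , eq = j , e , eq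
      -- The start already has this colour on its ray edge, so no attaching edge can repeat it.
      ... | inj₂ 0 , e , eq =
        contradiction (trans (unoriented (Edge-sym e) e) eq) (proper (Edge-sym e) up λ ())

    core+start-even : ∃[ k ] suc (suc D) ≡ 2 * k
    core+start-even = colour-class⇒even c _≟ᵛ_ ι ι-injective (colour start~0) mate
      where
      ι : Fin (suc (suc D)) → Fin (suc D) ⊎ ℕ
      ι zero    = inj₂ 0
      ι (suc i) = inj₁ i
      ι-injective : Injective _≡_ _≡_ ι
      ι-injective {zero}  {zero}  _    = refl
      ι-injective {suc i} {suc j} refl = refl
      mate : ∀ i → ∃[ j ] Σ[ e ∈ Edge (ι i) (ι j) ] colour e ≡ colour start~0
      mate zero = suc zero , start~0 , refl
      mate (suc i) with incident i (colour start~0)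
      ... | inj₁ j , e , eq = suc j , e , eq
      ... | inj₂ 0 , e , eq = zero , e , eq

  not-colourable : ¬ EdgeColourable D withRay
  not-colourable c =
    let k , 1+D≡2k = core-even c
        l , 2+D≡2l = core+start-even c
    in even≢odd l k (trans (sym 2+D≡2l) (cong suc 1+D≡2k))

theorem4p18 : (D : ℕ) → 3 ≤ D →
    (¬ Category.Meager (𝔊∞≤ D) Open (edgeColourables D)) ×
    (¬ Category.Comeager (𝔊∞≤ D) Open (edgeColourables D))
theorem4p18 D@(suc (suc (suc d))) (s≤s (s≤s (s≤s z≤n))) =
  isolated⇒nonmeager (edgeColourables D)
    (infiniteGraph emptyCore Ray.rigid ray≤D) (infiniteGraph-isolated emptyCore Ray.rigid ray≤D)
    Ray.edgeColouring ,
  isolated⇒nonmeager (complement (edgeColourables D))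
    (infiniteGraph subdivided rigid maxDegree≤) (infiniteGraph-isolated subdivided rigid maxDegree≤)
    not-colourable
  where
  open Subdivided d using (subdivided; rigid; maxDegree≤; not-colourable)
  ray≤D = Ray.maxDegree≤ (s≤s (s≤s z≤n))
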